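{- Let $G=(V,E,w)$ be a finite connected graph with $|V|=n\ge2$ and weights $w:E\to\mathbb{R}_{>0}$. Let $H$ be an arbitrary rooted binary hierarchy on $V$. There exists a rooted binary hierarchy $T$ on $V$, all of whose clusters induce connected subgraphs of $G$, such that for every edge $xy\in E$, $$|C_T(x,y)|\le|C_H(x,y)|.$$ Consequently, $$\operatorname{cost}_D^-(T)\le\operatorname{cost}_D^-(H)\quad\text{and}\quad\operatorname{cost}_D(T)\le\operatorname{cost}_D(H).$$
   Context: A rooted binary hierarchy $T$ on $V$ is a rooted tree whose leaves are the vertices of $V$ and whose internal nodes have exactly two children; each node is identified with the set of leaves in its subtree (a cluster), and $C_T(x,y)$ is the cluster of the lowest common ancestor of $x,y$. The standard and shifted Dasgupta objectives are $\operatorname{cost}_D(T)=\sum_{xy\in E}w_{xy}|C_T(x,y)|$ and $\operatorname{cost}_D^-(T)=\sum_{xy\in E}w_{xy}(|C_T(x,y)|-1)$. -}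

module Defs where

open import Data.Bool.Base using (if_then_else_)
open import Data.Fin.Base using (Fin)
open import Data.Fin.Subset using (Subset; _∈_; _∪_; ⁅_⁆; ∣_∣)
open import Data.Fin.Subset.Properties using (_∈?_)
open import Data.Integer.Base as ℤ using ()
open import Data.List.Base using (allFin)
open import Data.List.Relation.Binary.Permutation.Propositional using (_↭_)
open import Data.Nat.Base as ℕ using (ℕ)
import Data.Nat.Properties as ℕₚ
open import Data.Product.Base using (Σ-syntax; ∃-syntax; _×_; _,_; proj₁; proj₂)
open import Data.Rational.Base as ℚ using (ℚ; 0ℚ; 1ℚ; ½; _<_)
import Data.Rational.Properties as ℚₚ
open import Data.Rational.Solver using (module +-*-Solver)
open import Data.Sum.Base using (_⊎_)
open import Data.Tree.Binary using (Tree; leaf; node; module Leaves)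
open import Data.Unit.Base using (⊤)
import Data.Vec.Functional as Vector
open import Function.Base using (_on_)
open import Level using (0ℓ)
open import Relation.Binary.Core using (Rel)
open import Relation.Binary.Construct.Closure.ReflexiveTransitive using (Star)
open import Relation.Binary.PropositionalEquality
  using (_≡_; _≢_; refl; sym; trans; cong; cong₂; subst)
open import Relation.Nullary.Decidable.Core using (⌊_⌋; _×-dec_)

Cauchy : (ℕ → ℚ) → Set
Cauchy x = ∀ ε → 0ℚ < ε →
  ∃[ N ] (∀ {m n} → N ℕ.≤ m → N ℕ.≤ n → ℚ.∣ x m ℚ.- x n ∣ < ε)

-- Cauchy sequences are not quotiented by having the same limit: the order
-- relations below depend only on limits.
record ℝ : Set where
  constructor mkℝ
  field
    seq    : ℕ → ℚ
    cauchy : Cauchy seq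

open ℝ public

infix 4 _≤ℝ_ _<ℝ_

_≤ℝ_ : Rel ℝ 0ℓ
x ≤ℝ y = ∀ ε → 0ℚ < ε →
  ∃[ N ] (∀ {n} → N ℕ.≤ n → seq x n ℚ.≤ seq y n ℚ.+ ε)

-- A uniform gap is required, since the terms of a sequence may be
-- positive while its limit is zero.
_<ℝ_ : Rel ℝ 0ℓ
x <ℝ y = ∃[ ε ] (0ℚ < ε ×
  ∃[ N ] (∀ {n} → N ℕ.≤ n → seq x n ℚ.+ ε ℚ.≤ seq y n))

private
  module Rearrange where
    open +-*-Solver

    +-diff : ∀ a b c d →
      (a ℚ.+ b) ℚ.- (c ℚ.+ d) ≡ (a ℚ.- c) ℚ.+ (b ℚ.- d)
    +-diff = solve 4 (λ a b c d →
      (a :+ b) :- (c :+ d) := (a :- c) :+ (b :- d)) refl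

    *-diff : ∀ a b c d →
      a ℚ.* b ℚ.- c ℚ.* d ≡ a ℚ.* (b ℚ.- d) ℚ.+ d ℚ.* (a ℚ.- c)
    *-diff = solve 4 (λ a b c d →
      a :* b :- c :* d := a :* (b :- d) :+ d :* (a :- c)) refl

    split : ∀ a b → a ≡ b ℚ.+ (a ℚ.- b)
    split = solve 2 (λ a b → a := b :+ (a :- b)) refl

*-pos : ∀ p q → 0ℚ < p → 0ℚ < q → 0ℚ < p ℚ.* q
*-pos p q 0<p 0<q =
  ℚₚ.positive⁻¹ (p ℚ.* q)
    {{ℚₚ.pos*pos⇒pos p {{ℚ.positive 0<p}} q {{ℚ.positive 0<q}}}}

halve : ∀ ε → 0ℚ < ε → ∃[ δ ] (0ℚ < δ × δ ℚ.+ δ ≡ ε)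
halve ε 0<ε =
  ½ ℚ.* ε , *-pos ½ ε (ℚₚ.positive⁻¹ ½) 0<ε ,
  trans (sym (ℚₚ.*-distribʳ-+ ε ½ ½)) (ℚₚ.*-identityˡ ε)

divide : ∀ B ε → 0ℚ < B → 0ℚ < ε → ∃[ δ ] (0ℚ < δ × B ℚ.* δ ≡ ε)
divide B ε 0<B 0<ε =
  1/B ℚ.* ε ,
  *-pos 1/B ε (ℚₚ.positive⁻¹ 1/B {{ℚₚ.1/pos⇒pos B}}) 0<ε ,
  trans (sym (ℚₚ.*-assoc B 1/B ε))
    (trans (cong (ℚ._* ε) (ℚₚ.*-inverseʳ B)) (ℚₚ.*-identityˡ ε))
  where
  instance
    B⁺ : ℚ.Positive B
    B⁺ = ℚ.positive 0<B
    B≢0 : ℚ.NonZero B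
    B≢0 = ℚₚ.pos⇒nonZero B
  1/B : ℚ
  1/B = ℚ.1/ B

∣*∣-bound : ∀ a b {B δ} → 0ℚ < B →
  ℚ.∣ a ∣ ℚ.≤ B → ℚ.∣ b ∣ < δ → ℚ.∣ a ℚ.* b ∣ < B ℚ.* δ
∣*∣-bound a b {B} {δ} 0<B a≤B b<δ = begin-strict
  ℚ.∣ a ℚ.* b ∣        ≡⟨ ℚₚ.∣p*q∣≡∣p∣*∣q∣ a b ⟩
  ℚ.∣ a ∣ ℚ.* ℚ.∣ b ∣  ≤⟨ ℚₚ.*-monoʳ-≤-nonNeg ℚ.∣ b ∣ {{ℚₚ.∣-∣-nonNeg b}} a≤B ⟩
  B ℚ.* ℚ.∣ b ∣        <⟨ ℚₚ.*-monoʳ-<-pos B {{ℚ.positive 0<B}} b<δ ⟩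
  B ℚ.* δ              ∎
  where open ℚₚ.≤-Reasoning

cauchy-const : ∀ q → Cauchy (λ _ → q)
cauchy-const q ε 0<ε =
  0 , λ _ _ → subst (λ d → ℚ.∣ d ∣ < ε) (sym (ℚₚ.+-inverseʳ q)) 0<ε

cauchy-neg : ∀ x → Cauchy x → Cauchy (λ n → ℚ.- x n)
cauchy-neg x cx ε 0<ε = cx ε 0<ε .proj₁ , λ {m} {n} p q →
  subst (_< ε)
    (trans (sym (ℚₚ.∣-p∣≡∣p∣ (x m ℚ.- x n)))
           (cong ℚ.∣_∣ (ℚₚ.neg-distrib-+ (x m) (ℚ.- x n))))
    (cx ε 0<ε .proj₂ p q)

cauchy-+ : ∀ x y → Cauchy x → Cauchy y → Cauchy (λ n → x n ℚ.+ y n)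
cauchy-+ x y cx cy ε 0<ε =
  let δ , 0<δ , δ+δ≡ε = halve ε 0<ε
      M , hx = cx δ 0<δ
      N , hy = cy δ 0<δ
  in M ℕ.⊔ N , λ {m} {n} p q → begin-strict
    ℚ.∣ (x m ℚ.+ y m) ℚ.- (x n ℚ.+ y n) ∣
      ≡⟨ cong ℚ.∣_∣ (Rearrange.+-diff (x m) (y m) (x n) (y n)) ⟩
    ℚ.∣ (x m ℚ.- x n) ℚ.+ (y m ℚ.- y n) ∣
      ≤⟨ ℚₚ.∣p+q∣≤∣p∣+∣q∣ (x m ℚ.- x n) (y m ℚ.- y n) ⟩
    ℚ.∣ x m ℚ.- x n ∣ ℚ.+ ℚ.∣ y m ℚ.- y n ∣
      <⟨ ℚₚ.+-mono-< (hx (ℕₚ.m⊔n≤o⇒m≤o M N p) (ℕₚ.m⊔n≤o⇒m≤o M N q))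
                     (hy (ℕₚ.m⊔n≤o⇒n≤o M N p) (ℕₚ.m⊔n≤o⇒n≤o M N q)) ⟩
    δ ℚ.+ δ
      ≡⟨ δ+δ≡ε ⟩
    ε ∎
  where open ℚₚ.≤-Reasoning

cauchy-bounded : ∀ x → Cauchy x →
  ∃[ B ] (0ℚ < B × ∃[ N ] (∀ {n} → N ℕ.≤ n → ℚ.∣ x n ∣ ℚ.≤ B))
cauchy-bounded x cx =
  let N , h = cx 1ℚ (ℚₚ.positive⁻¹ 1ℚ)
  in ℚ.∣ x N ∣ ℚ.+ 1ℚ ,
     ℚₚ.+-mono-≤-< (ℚₚ.0≤∣p∣ (x N)) (ℚₚ.positive⁻¹ 1ℚ) ,
     N , λ {n} p → begin
       ℚ.∣ x n ∣
         ≡⟨ cong ℚ.∣_∣ (Rearrange.split (x n) (x N)) ⟩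
       ℚ.∣ x N ℚ.+ (x n ℚ.- x N) ∣
         ≤⟨ ℚₚ.∣p+q∣≤∣p∣+∣q∣ (x N) (x n ℚ.- x N) ⟩
       ℚ.∣ x N ∣ ℚ.+ ℚ.∣ x n ℚ.- x N ∣
         ≤⟨ ℚₚ.+-monoʳ-≤ ℚ.∣ x N ∣ (ℚₚ.<⇒≤ (h p ℕₚ.≤-refl)) ⟩
       ℚ.∣ x N ∣ ℚ.+ 1ℚ ∎
  where open ℚₚ.≤-Reasoning

cauchy-* : ∀ x y → Cauchy x → Cauchy y → Cauchy (λ n → x n ℚ.* y n)
cauchy-* x y cx cy ε 0<ε =
  let ζ , 0<ζ , ζ+ζ≡ε = halve ε 0<ε
      A , 0<A , K , bx = cauchy-bounded x cx
      B , 0<B , L , by = cauchy-bounded y cy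
      δ , 0<δ , Aδ≡ζ = divide A ζ 0<A 0<ζ
      η , 0<η , Bη≡ζ = divide B ζ 0<B 0<ζ
      M , hy = cy δ 0<δ
      N , hx = cx η 0<η
  in (K ℕ.⊔ L) ℕ.⊔ (M ℕ.⊔ N) , λ {m} {n} p q →
  let p₁ = ℕₚ.m⊔n≤o⇒m≤o (K ℕ.⊔ L) (M ℕ.⊔ N) p
      p₂ = ℕₚ.m⊔n≤o⇒n≤o (K ℕ.⊔ L) (M ℕ.⊔ N) p
      q₁ = ℕₚ.m⊔n≤o⇒m≤o (K ℕ.⊔ L) (M ℕ.⊔ N) q
      q₂ = ℕₚ.m⊔n≤o⇒n≤o (K ℕ.⊔ L) (M ℕ.⊔ N) q
      s  = ∣*∣-bound (x m) (y m ℚ.- y n) 0<A (bx (ℕₚ.m⊔n≤o⇒m≤o K L p₁))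
             (hy (ℕₚ.m⊔n≤o⇒m≤o M N p₂) (ℕₚ.m⊔n≤o⇒m≤o M N q₂))
      t  = ∣*∣-bound (y n) (x m ℚ.- x n) 0<B (by (ℕₚ.m⊔n≤o⇒n≤o K L q₁))
             (hx (ℕₚ.m⊔n≤o⇒n≤o M N p₂) (ℕₚ.m⊔n≤o⇒n≤o M N q₂))
  in begin-strict
    ℚ.∣ x m ℚ.* y m ℚ.- x n ℚ.* y n ∣
      ≡⟨ cong ℚ.∣_∣ (Rearrange.*-diff (x m) (y m) (x n) (y n)) ⟩
    ℚ.∣ x m ℚ.* (y m ℚ.- y n) ℚ.+ y n ℚ.* (x m ℚ.- x n) ∣
      ≤⟨ ℚₚ.∣p+q∣≤∣p∣+∣q∣ (x m ℚ.* (y m ℚ.- y n)) (y n ℚ.* (x m ℚ.- x n)) ⟩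
    ℚ.∣ x m ℚ.* (y m ℚ.- y n) ∣ ℚ.+ ℚ.∣ y n ℚ.* (x m ℚ.- x n) ∣
      <⟨ ℚₚ.+-mono-< s t ⟩
    A ℚ.* δ ℚ.+ B ℚ.* η
      ≡⟨ cong₂ ℚ._+_ Aδ≡ζ Bη≡ζ ⟩
    ζ ℚ.+ ζ
      ≡⟨ ζ+ζ≡ε ⟩
    ε ∎
  where open ℚₚ.≤-Reasoning

infix  8 -ℝ_
infixl 7 _*ℝ_
infixl 6 _+ℝ_ _-ℝ_

fromℚ : ℚ → ℝ
fromℚ q = mkℝ (λ _ → q) (cauchy-const q)

fromℕ : ℕ → ℝ
fromℕ n = fromℚ (ℤ.+ n ℚ./ 1)

0ℝ 1ℝ : ℝ
0ℝ = fromℚ 0ℚ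
1ℝ = fromℚ 1ℚ

-ℝ_ : ℝ → ℝ
-ℝ x = mkℝ (λ n → ℚ.- seq x n) (cauchy-neg (seq x) (cauchy x))

_+ℝ_ _-ℝ_ _*ℝ_ : ℝ → ℝ → ℝ
x +ℝ y = mkℝ (λ n → seq x n ℚ.+ seq y n)
             (cauchy-+ (seq x) (seq y) (cauchy x) (cauchy y))
x -ℝ y = x +ℝ (-ℝ y)
x *ℝ y = mkℝ (λ n → seq x n ℚ.* seq y n)
             (cauchy-* (seq x) (seq y) (cauchy x) (cauchy y))

sumℝ : ∀ {m} → (Fin m → ℝ) → ℝ
sumℝ = Vector.foldr _+ℝ_ 0ℝ

-- The edge set is Fin size; the two endpoints of an edge are listed in
-- an arbitrary order.
record Graph (n : ℕ) : Set where
  field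
    size : ℕ
    src  : Fin size → Fin n
    tgt  : Fin size → Fin n

  Joins : Fin size → Fin n → Fin n → Set
  Joins e x y = (src e ≡ x × tgt e ≡ y) ⊎ (src e ≡ y × tgt e ≡ x)

  field
    loopless : ∀ e → src e ≢ tgt e
    simple   : ∀ {d e x y} → Joins d x y → Joins e x y → d ≡ e

  Edge : Set
  Edge = Fin size

  Adjacent : Rel (Fin n) 0ℓ
  Adjacent x y = Σ[ e ∈ Edge ] Joins e x y

  Induced : (S : Subset n) → Rel (Σ[ x ∈ Fin n ] x ∈ S) 0ℓ
  Induced S = Adjacent on proj₁

Connected : {A : Set} → Rel A 0ℓ → Set
Connected R = ∀ x y → Star R x y

-- Trees are plane, but the set of clusters does not depend on the order
-- of children.
BinaryTree : ℕ → Set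
BinaryTree n = Tree ⊤ (Fin n)

record Hierarchy (n : ℕ) : Set where
  constructor mkHierarchy
  field
    tree   : BinaryTree n
    leaves : Leaves.toList tree ↭ allFin n

open Hierarchy public

module _ {n : ℕ} where

  cluster : BinaryTree n → Subset n
  cluster (leaf x)     = ⁅ x ⁆
  cluster (node l _ r) = cluster l ∪ cluster r

  infix 4 _⊑_

  -- s ⊑ t: s is the subtree rooted at some node of t.
  data _⊑_ (s : BinaryTree n) : BinaryTree n → Set where
    here  : s ⊑ s
    left  : ∀ {l u r} → s ⊑ l → s ⊑ node l u r
    right : ∀ {l u r} → s ⊑ r → s ⊑ node l u r

  -- The subtree rooted at the lowest common ancestor of x and y, provided
  -- both label leaves of the tree and no label is repeated.
  lca : BinaryTree n → Fin n → Fin n → BinaryTree n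
  lca t@(leaf _)     x y = t
  lca t@(node l _ r) x y =
    if ⌊ (x ∈? cluster l) ×-dec (y ∈? cluster l) ⌋ then lca l x y else
    if ⌊ (x ∈? cluster r) ×-dec (y ∈? cluster r) ⌋ then lca r x y else
    t

  C : Hierarchy n → Fin n → Fin n → Subset n
  C T x y = cluster (lca (tree T) x y)

module _ {n : ℕ} (G : Graph n) (w : Graph.Edge G → ℝ) where
  open Graph G

  costD : Hierarchy n → ℝ
  costD T = sumℝ λ e → w e *ℝ fromℕ ∣ C T (src e) (tgt e) ∣

  costD⁻ : Hierarchy n → ℝ
  costD⁻ T = sumℝ λ e → w e *ℝ (fromℕ ∣ C T (src e) (tgt e) ∣ -ℝ 1ℝ)

{-# OPTIONS --safe #-}
module Submission where

-- Every cluster S of H splits into the connected components of G[S]. As S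
-- runs over the clusters of H from the leaves upwards, these components form
-- a laminar family of connected sets, and T is a binary refinement of it.
-- Suppose S is the union of the child clusters A and B. Each component of
-- G[S] is a union of components of G[A] and of G[B], and the hierarchies
-- already built on those are fused two at a time, always along an edge of G,
-- so that every intermediate cluster is connected too (`components`).
--
-- The bound on an edge xy is found at the lowest common ancestor of x and y
-- in H, with cluster S. Since x and y are adjacent, they lie in one component
-- of G[S]; the hierarchy on that component contains both, so their common
-- ancestor there has a cluster inside S. All later fusions put this hierarchy
-- below new nodes and leave the common ancestor as it is
-- (`components-Within`). At the root of H there is a single component,
-- because G is connected (`apart-singleton`), and its hierarchy is T.
--
-- The two cost inequalities follow term by term. A positive real has
-- eventually positive terms, so multiplying by it preserves the order that
-- compares two sequences from some index on; this order is compatible with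
-- finite sums and implies the order of the reals.

open import Defs
open import Data.Empty using (⊥-elim)
open import Data.Fin.Base using (Fin; zero; suc)
open import Data.Fin.Properties as Fin using (any?)
open import Data.Fin.Subset using (Subset; _∈_; _∉_; _⊆_; _∪_; ∣_∣)
open import Data.Fin.Subset.Properties
  using (_∈?_; x∈⁅x⁆; x∈⁅y⁆⇒x≡y; p⊆p∪q; q⊆p∪q; x∈p∪q⁻; x∈p∪q⁺; p⊆q⇒∣p∣≤∣q∣)
open import Data.Integer.Base as ℤ using ()
import Data.Integer.Properties as ℤₚ
open import Data.List.Base using (List; []; _∷_; [_]; _++_; concatMap)
import Data.List.Membership.Propositional as List
open import Data.List.Membership.Propositional.Properties
  using (∈-++⁺ˡ; ∈-++⁺ʳ; ∈-++⁻; ∈-allFin)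
open import Data.List.Properties using (++-assoc; ++-identityʳ; concatMap-++)
open import Data.List.Relation.Binary.Permutation.Propositional
  using (_↭_; ↭-refl; ↭-reflexive; ↭-sym; ↭-trans; ↭⇒↭ₛ; module PermutationReasoning)
open import Data.List.Relation.Binary.Permutation.Propositional.Properties
  using (∈-resp-↭; ++⁺; ++⁺ˡ; shifts)
import Data.List.Relation.Binary.Permutation.Setoid.Properties as Permutation
open import Data.List.Relation.Unary.All as All using (All; []; _∷_)
import Data.List.Relation.Unary.All.Properties as Allₚ
open import Data.List.Relation.Unary.AllPairs as AllPairs using (AllPairs; []; _∷_)
import Data.List.Relation.Unary.AllPairs.Properties as AllPairsₚ
open import Data.List.Relation.Unary.Any as Any using (Any; here; there)
import Data.List.Relation.Unary.Any.Properties as Anyₚ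
open import Data.List.Relation.Unary.Unique.Propositional using (Unique)
open import Data.List.Relation.Unary.Unique.Propositional.Properties using (allFin⁺)
open import Data.Nat.Base as ℕ using (ℕ; _≤_)
import Data.Nat.Properties as ℕₚ
open import Data.Product.Base using (Σ-syntax; ∃-syntax; _×_; _,_; proj₁)
open import Data.Rational.Base as ℚ using (0ℚ)
import Data.Rational.Properties as ℚₚ
import Data.Rational.Unnormalised.Base as ℚᵘ
import Data.Rational.Unnormalised.Properties as ℚᵘₚ
open import Data.Sum.Base as Sum using (_⊎_; inj₁; inj₂)
open import Data.Tree.Binary using (leaf; node; module Leaves)
open import Data.Vec.Properties.WithK using ([]=-irrelevant)
open import Function.Base using (_∘_)
open import Relation.Binary.Construct.Closure.ReflexiveTransitive
  using (Star; ε; _◅_; _◅◅_; gmap; reverse)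
open import Relation.Binary.PropositionalEquality
  using (_≡_; refl; sym; trans; cong; subst; setoid; module ≡-Reasoning)
open import Relation.Nullary using (¬_; Dec; yes; no; contradiction)
open import Relation.Nullary.Decidable using (_×-dec_; _⊎-dec_)

-- Monotonicity of the costs

infix 4 _≤∞_

-- Stronger than the order of the reals and dependent on the representing
-- sequences, but free of error terms: adding such inequalities or multiplying
-- them by a positive real needs no estimates.
_≤∞_ : ℝ → ℝ → Set
x ≤∞ y = ∃[ N ] (∀ {n} → N ≤ n → seq x n ℚ.≤ seq y n)

≤∞⇒≤ℝ : ∀ x y → x ≤∞ y → x ≤ℝ y
≤∞⇒≤ℝ x y (N , h) δ 0<δ = N , λ {n} N≤n → begin
  seq x n          ≤⟨ h N≤n ⟩
  seq y n          ≡⟨ ℚₚ.+-identityʳ (seq y n) ⟨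
  seq y n ℚ.+ 0ℚ   ≤⟨ ℚₚ.+-monoʳ-≤ (seq y n) (ℚₚ.<⇒≤ 0<δ) ⟩
  seq y n ℚ.+ δ    ∎
  where open ℚₚ.≤-Reasoning

sumℝ-mono : ∀ {m} (f g : Fin m → ℝ) → (∀ i → f i ≤∞ g i) → sumℝ f ≤∞ sumℝ g
sumℝ-mono {ℕ.zero}  f g h = 0 , λ _ → ℚₚ.≤-refl
sumℝ-mono {ℕ.suc m} f g h =
  let M , head = h zero
      N , tail = sumℝ-mono (f ∘ suc) (g ∘ suc) (h ∘ suc)
  in M ℕ.⊔ N , λ p →
    ℚₚ.+-mono-≤ (head (ℕₚ.m⊔n≤o⇒m≤o M N p)) (tail (ℕₚ.m⊔n≤o⇒n≤o M N p))

*ℝ-monoˡ : ∀ w x y → 0ℝ <ℝ w → x ≤∞ y → w *ℝ x ≤∞ w *ℝ y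
*ℝ-monoˡ w x y (δ , 0<δ , M , pos) (N , x≤y) = M ℕ.⊔ N , λ {n} p →
  ℚₚ.*-monoˡ-≤-nonNeg (seq w n) {{ℚ.nonNegative (0≤w (ℕₚ.m⊔n≤o⇒m≤o M N p))}}
    (x≤y (ℕₚ.m⊔n≤o⇒n≤o M N p))
  where
  0≤w : ∀ {n} → M ≤ n → 0ℚ ℚ.≤ seq w n
  0≤w {n} p = begin
    0ℚ         ≤⟨ ℚₚ.<⇒≤ 0<δ ⟩
    δ          ≡⟨ ℚₚ.+-identityˡ δ ⟨
    0ℚ ℚ.+ δ   ≤⟨ pos p ⟩
    seq w n    ∎
    where open ℚₚ.≤-Reasoning

-- Both fractions are compared in unnormalised form, where the denominators
-- are visibly 1 and the claim is one about integers.
/1-mono : ∀ {m n} → m ≤ n → ℤ.+ m ℚ./ 1 ℚ.≤ ℤ.+ n ℚ./ 1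
/1-mono {m} {n} m≤n = ℚₚ.toℚᵘ-cancel-≤ (begin
  ℚ.toℚᵘ (ℤ.+ m ℚ./ 1)  ≃⟨ ℚₚ.toℚᵘ-fromℚᵘ (ℚᵘ.mkℚᵘ (ℤ.+ m) 0) ⟩
  ℚᵘ.mkℚᵘ (ℤ.+ m) 0     ≤⟨ ℚᵘ.*≤* (ℤₚ.*-monoʳ-≤-nonNeg (ℤ.+ 1) (ℤ.+≤+ m≤n)) ⟩
  ℚᵘ.mkℚᵘ (ℤ.+ n) 0     ≃⟨ ℚₚ.toℚᵘ-fromℚᵘ (ℚᵘ.mkℚᵘ (ℤ.+ n) 0) ⟨
  ℚ.toℚᵘ (ℤ.+ n ℚ./ 1)  ∎)
  where open ℚᵘₚ.≤-Reasoning

fromℕ-mono : ∀ {m n} → m ≤ n → fromℕ m ≤∞ fromℕ n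
fromℕ-mono m≤n = 0 , λ _ → /1-mono m≤n

-ℝ-monoˡ : ∀ x y z → x ≤∞ y → x -ℝ z ≤∞ y -ℝ z
-ℝ-monoˡ x y z (N , x≤y) = N , λ {n} p → ℚₚ.+-monoˡ-≤ (ℚ.- seq z n) (x≤y p)

module _ {n : ℕ} (G : Graph n) (w : Graph.Edge G → ℝ) (0<w : ∀ e → 0ℝ <ℝ w e)
  (T H : Hierarchy n)
  (C≤C : ∀ x y → Graph.Adjacent G x y → ∣ C T x y ∣ ≤ ∣ C H x y ∣) where
  open Graph G

  private
    size-T size-H : Edge → ℝ
    size-T e = fromℕ ∣ C T (src e) (tgt e) ∣
    size-H e = fromℕ ∣ C H (src e) (tgt e) ∣

    sizes : ∀ e → size-T e ≤∞ size-H e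
    sizes e = fromℕ-mono (C≤C (src e) (tgt e) (e , inj₁ (refl , refl)))

  costD-mono : costD G w T ≤ℝ costD G w H
  costD-mono = ≤∞⇒≤ℝ (costD G w T) (costD G w H)
    (sumℝ-mono _ _ λ e → *ℝ-monoˡ (w e) (size-T e) (size-H e) (0<w e) (sizes e))

  costD⁻-mono : costD⁻ G w T ≤ℝ costD⁻ G w H
  costD⁻-mono = ≤∞⇒≤ℝ (costD⁻ G w T) (costD⁻ G w H)
    (sumℝ-mono _ _ λ e →
      *ℝ-monoˡ (w e) (size-T e -ℝ 1ℝ) (size-H e -ℝ 1ℝ) (0<w e)
        (-ℝ-monoˡ (size-T e) (size-H e) 1ℝ (sizes e)))

-- Clusters and lowest common ancestors

Unique-++⁻ : ∀ {A : Set} (xs : List A) {ys} → Unique (xs ++ ys) →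
  Unique xs × Unique ys × (∀ {x} → x List.∈ xs → ¬ x List.∈ ys)
Unique-++⁻ []       u       = [] , u , λ ()
Unique-++⁻ (x ∷ xs) (x∉ ∷ u) =
  let uxs , uys , disjoint = Unique-++⁻ xs u
  in Allₚ.++⁻ˡ xs x∉ ∷ uxs , uys , λ
    { (here refl) x∈ys → All.lookup (Allₚ.++⁻ʳ xs x∉) x∈ys refl
    ; (there x∈xs)     → disjoint x∈xs }

module _ {n : ℕ} where

  leavesOf : BinaryTree n → List (Fin n)
  leavesOf = Leaves.toList

  private
    -- Leaves are collected through difference lists; this removes the
    -- accumulator.
    toDiffList-++ : ∀ (t : BinaryTree n) xs →
      Leaves.toDiffList t xs ≡ leavesOf t ++ xs
    toDiffList-++ (leaf x)     xs = refl
    toDiffList-++ (node l u r) xs = begin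
      Leaves.toDiffList l (Leaves.toDiffList r xs)
        ≡⟨ toDiffList-++ l _ ⟩
      leavesOf l ++ Leaves.toDiffList r xs
        ≡⟨ cong (leavesOf l ++_) (toDiffList-++ r xs) ⟩
      leavesOf l ++ leavesOf r ++ xs
        ≡⟨ ++-assoc (leavesOf l) (leavesOf r) xs ⟨
      (leavesOf l ++ leavesOf r) ++ xs
        ≡⟨ cong (_++ xs) (toDiffList-++ l (leavesOf r)) ⟨
      leavesOf (node l u r) ++ xs ∎
      where open ≡-Reasoning

  leavesOf-node : ∀ l u r → leavesOf (node l u r) ≡ leavesOf l ++ leavesOf r
  leavesOf-node l u r = toDiffList-++ l (leavesOf r)

  cluster⇒leaf : ∀ (t : BinaryTree n) {x} → x ∈ cluster t → x List.∈ leavesOf t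
  cluster⇒leaf (leaf y) x∈ = here (x∈⁅y⁆⇒x≡y y x∈)
  cluster⇒leaf (node l u r) x∈ rewrite leavesOf-node l u r
    with x∈p∪q⁻ (cluster l) (cluster r) x∈
  ... | inj₁ x∈l = ∈-++⁺ˡ (cluster⇒leaf l x∈l)
  ... | inj₂ x∈r = ∈-++⁺ʳ (leavesOf l) (cluster⇒leaf r x∈r)

  leaf⇒cluster : ∀ (t : BinaryTree n) {x} → x List.∈ leavesOf t → x ∈ cluster t
  leaf⇒cluster (leaf y) (here refl) = x∈⁅x⁆ y
  leaf⇒cluster (node l u r) x∈ rewrite leavesOf-node l u r =
    x∈p∪q⁺ (Sum.map (leaf⇒cluster l) (leaf⇒cluster r) (∈-++⁻ (leavesOf l) x∈))

  cluster-nonempty : ∀ (t : BinaryTree n) → ∃[ x ] x ∈ cluster t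
  cluster-nonempty (leaf x)     = x , x∈⁅x⁆ x
  cluster-nonempty (node l u r) =
    let x , x∈l = cluster-nonempty l in x , p⊆p∪q (cluster r) x∈l

  -- A record rather than a function type, so that the two trees can be
  -- recovered from the type of a proof.
  record Disjoint (t s : BinaryTree n) : Set where
    constructor disjoint
    field separate : ∀ {x} → x ∈ cluster t → x ∉ cluster s

  open Disjoint public

  Disjoint-node : ∀ {t s u v} → Disjoint t u → Disjoint s u → Disjoint (node t v s) u
  Disjoint-node {t} {s} (disjoint t#u) (disjoint s#u) =
    disjoint λ x∈ → Sum.[ t#u , s#u ] (x∈p∪q⁻ (cluster t) (cluster s) x∈)

  Disjoint-sym : ∀ {t s} → Disjoint t s → Disjoint s t
  Disjoint-sym (disjoint t#s) = disjoint λ x∈s x∈t → t#s x∈t x∈s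

  Unique-node : ∀ l u r → Unique (leavesOf (node l u r)) →
    Unique (leavesOf l) × Unique (leavesOf r) × Disjoint l r
  Unique-node l u r unique rewrite leavesOf-node l u r =
    let unique-l , unique-r , l#r = Unique-++⁻ (leavesOf l) unique
    in unique-l , unique-r ,
       disjoint λ x∈l x∈r → l#r (cluster⇒leaf l x∈l) (cluster⇒leaf r x∈r)

  lca⊆ : ∀ (t : BinaryTree n) x y → cluster (lca t x y) ⊆ cluster t
  lca⊆ (leaf _) x y z∈ = z∈
  lca⊆ (node l _ r) x y z∈
    with (x ∈? cluster l) ×-dec (y ∈? cluster l)
       | (x ∈? cluster r) ×-dec (y ∈? cluster r)
  ... | yes _ | _     = p⊆p∪q (cluster r) (lca⊆ l x y z∈)
  ... | no _  | yes _ = q⊆p∪q (cluster l) (cluster r) (lca⊆ r x y z∈)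
  ... | no _  | no _  = z∈

  lca-nodeˡ : ∀ {l r : BinaryTree n} {u x y} → x ∈ cluster l → y ∈ cluster l →
    lca (node l u r) x y ≡ lca l x y
  lca-nodeˡ {l} {x = x} {y} x∈l y∈l
    with (x ∈? cluster l) ×-dec (y ∈? cluster l)
  ... | yes _  = refl
  ... | no ¬xy = contradiction (x∈l , y∈l) ¬xy

  -- The left child is searched first, so disjointness is what sends the search
  -- to the right.
  lca-nodeʳ : ∀ {l u r x y} → Disjoint l r → x ∈ cluster r → y ∈ cluster r →
    lca (node l u r) x y ≡ lca r x y
  lca-nodeʳ {l} {r = r} {x} {y} l#r x∈r y∈r
    with (x ∈? cluster l) ×-dec (y ∈? cluster l)
       | (x ∈? cluster r) ×-dec (y ∈? cluster r)
  ... | yes (x∈l , _) | _      = contradiction x∈r (separate l#r x∈l)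
  ... | no _          | yes _  = refl
  ... | no _          | no ¬xy = contradiction (x∈r , y∈r) ¬xy

  record Within (k : ℕ) (x y : Fin n) (t : BinaryTree n) : Set where
    constructor within
    field
      ∈ˡ      : x ∈ cluster t
      ∈ʳ      : y ∈ cluster t
      lcaSize : ∣ cluster (lca t x y) ∣ ≤ k

  open Within public

  -- Placing a tree below a new node keeps the common ancestors inside it, which
  -- is why fusing trees never spoils a bound already reached.
  Within-nodeˡ : ∀ {k x y t u s} → Within k x y t → Within k x y (node t u s)
  Within-nodeˡ {k} {t = t} {s = s} (within x∈t y∈t ≤k) =
    within (p⊆p∪q (cluster s) x∈t) (p⊆p∪q (cluster s) y∈t)
      (subst (λ v → ∣ cluster v ∣ ≤ k) (sym (lca-nodeˡ {l = t} {r = s} x∈t y∈t)) ≤k)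

  Within-nodeʳ : ∀ {k x y t u s} → Disjoint t s →
    Within k x y s → Within k x y (node t u s)
  Within-nodeʳ {k} {t = t} {s = s} t#s (within x∈s y∈s ≤k) =
    within (q⊆p∪q (cluster t) (cluster s) x∈s) (q⊆p∪q (cluster t) (cluster s) y∈s)
      (subst (λ v → ∣ cluster v ∣ ≤ k) (sym (lca-nodeʳ t#s x∈s y∈s)) ≤k)

  Forest : Set
  Forest = List (BinaryTree n)

  forestLeaves : Forest → List (Fin n)
  forestLeaves = concatMap leavesOf

module ConnectedRefinement {n : ℕ} (G : Graph n) where
  open Graph G

  -- Connected sets of vertices

  Adjacent-sym : ∀ {x y} → Adjacent x y → Adjacent y x
  Adjacent-sym (e , joins) = e , Sum.swap joins

  adjacent? : ∀ x y → Dec (Adjacent x y)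
  adjacent? x y = any? λ e →
    ((src e Fin.≟ x) ×-dec (tgt e Fin.≟ y)) ⊎-dec
    ((src e Fin.≟ y) ×-dec (tgt e Fin.≟ x))

  Linked : Subset n → Subset n → Set
  Linked p q = ∃[ x ] ∃[ y ] (x ∈ p × y ∈ q × Adjacent x y)

  linked? : ∀ p q → Dec (Linked p q)
  linked? p q = any? λ x → any? λ y →
    (x ∈? p) ×-dec ((y ∈? q) ×-dec adjacent? x y)

  Linked-∪⁻ : ∀ {p p′ q} → Linked (p ∪ p′) q → Linked p q ⊎ Linked p′ q
  Linked-∪⁻ {p} {p′} (x , y , x∈ , y∈q , xy) with x∈p∪q⁻ p p′ x∈
  ... | inj₁ x∈p  = inj₁ (x , y , x∈p , y∈q , xy)
  ... | inj₂ x∈p′ = inj₂ (x , y , x∈p′ , y∈q , xy)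

  Linked-sym : ∀ {p q} → Linked p q → Linked q p
  Linked-sym (x , y , x∈p , y∈q , xy) = y , x , y∈q , x∈p , Adjacent-sym xy

  Induced-mono : ∀ {p q} (p⊆q : p ⊆ q) {x y} {x∈p : x ∈ p} {y∈p : y ∈ p} →
    Star (Induced p) (x , x∈p) (y , y∈p) →
    Star (Induced q) (x , p⊆q x∈p) (y , p⊆q y∈p)
  Induced-mono p⊆q = gmap (λ (x , x∈p) → x , p⊆q x∈p) λ xy → xy

  -- Vertices of an induced subgraph carry a proof of membership, so the empty
  -- walk only serves once the two proofs are identified.
  connected-⁅⁆ : ∀ x → Connected (Induced (cluster (leaf x)))
  connected-⁅⁆ x (y , y∈) (z , z∈)
    with refl ← x∈⁅y⁆⇒x≡y x y∈ | refl ← x∈⁅y⁆⇒x≡y x z∈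
    with refl ← []=-irrelevant y∈ z∈ = ε

  -- All vertices reach one end of the edge between the two sets, those of the
  -- second set by crossing that edge last.
  connected-∪ : ∀ {p q} → Linked p q →
    Connected (Induced p) → Connected (Induced q) → Connected (Induced (p ∪ q))
  connected-∪ {p} {q} (x , y , x∈p , y∈q , xy) conn-p conn-q a b =
    toHub a ◅◅ reverse Adjacent-sym (toHub b)
    where
    hub : Σ[ z ∈ Fin n ] z ∈ p ∪ q
    hub = x , p⊆p∪q q x∈p

    toHub : ∀ a → Star (Induced (p ∪ q)) a hub
    toHub (z , z∈) with x∈p∪q⁻ p q z∈
    ... | inj₁ z∈p rewrite []=-irrelevant z∈ (p⊆p∪q q z∈p) =
      Induced-mono (p⊆p∪q q) (conn-p (z , z∈p) (x , x∈p))
    ... | inj₂ z∈q rewrite []=-irrelevant z∈ (q⊆p∪q p q z∈q) =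
      Induced-mono (q⊆p∪q p q) (conn-q (z , z∈q) (y , y∈q))
        ◅◅ Adjacent-sym xy ◅ ε

  Apart : BinaryTree n → BinaryTree n → Set
  Apart t s = Disjoint t s × ¬ Linked (cluster t) (cluster s)

  Apart-node : ∀ {t s u v} → Apart t u → Apart s u → Apart (node t v s) u
  Apart-node (t#u , t≁u) (s#u , s≁u) =
    Disjoint-node t#u s#u , λ link → Sum.[ t≁u , s≁u ] (Linked-∪⁻ link)

  Apart-sym : ∀ {t s} → Apart t s → Apart s t
  Apart-sym (t#s , t≁s) = Disjoint-sym t#s , t≁s ∘ Linked-sym

  AllConnected : BinaryTree n → Set
  AllConnected t = ∀ s → s ⊑ t → Connected (Induced (cluster s))

  AllConnected-leaf : ∀ x → AllConnected (leaf x)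
  AllConnected-leaf x _ here = connected-⁅⁆ x

  AllConnected-node : ∀ {t s u} → Linked (cluster t) (cluster s) →
    AllConnected t → AllConnected s → AllConnected (node t u s)
  AllConnected-node link conn-t conn-s _ here =
    connected-∪ link (conn-t _ here) (conn-s _ here)
  AllConnected-node link conn-t conn-s v (left v⊑t)  = conn-t v v⊑t
  AllConnected-node link conn-t conn-s v (right v⊑s) = conn-s v v⊑s

  -- Fusing trees along edges

  -- In a forest whose trees are pairwise not linked, one pass suffices: a tree s
  -- that is passed over is linked neither to t nor to any later tree, hence not
  -- to whatever t grows into.
  insert : BinaryTree n → Forest → Forest
  insert t []      = [ t ]
  insert t (s ∷ F) with linked? (cluster t) (cluster s)
  ... | yes _ = insert (node t _ s) F
  ... | no  _ = s ∷ insert t F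

  -- Applied to disjoint trees with connected clusters, this leaves one tree for
  -- each connected component of the graph induced on their union.
  gather : Forest → Forest
  gather []      = []
  gather (t ∷ F) = insert t (gather F)

  -- The properties that fusion keeps true of every tree. The link is at hand
  -- because trees are fused only along an edge; connectedness depends on it.
  LinkClosed : (BinaryTree n → Set) → Set
  LinkClosed Q = ∀ {t s} → Linked (cluster t) (cluster s) → Q t → Q s → Q (node t _ s)

  insert-All : ∀ {Q} → LinkClosed Q → ∀ {t F} → Q t → All Q F → All Q (insert t F)
  insert-All closed qt []           = qt ∷ []
  insert-All closed {t} {s ∷ F} qt (qs ∷ qF) with linked? (cluster t) (cluster s)
  ... | yes link = insert-All closed (closed link qt qs) qF
  ... | no  _    = qs ∷ insert-All closed qt qF

  gather-All : ∀ {Q} → LinkClosed Q → ∀ {F} → All Q F → All Q (gather F)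
  gather-All closed []        = []
  gather-All closed (qt ∷ qF) = insert-All closed qt (gather-All closed qF)

  private
    Disjoint-nodes : ∀ {t s : BinaryTree n} {F} → All (Disjoint t) F → All (Disjoint s) F →
      All (Disjoint (node t _ s)) F
    Disjoint-nodes t#F s#F =
      All.zipWith (λ (t#u , s#u) → Disjoint-node t#u s#u) (t#F , s#F)

    gather-Disjoint : ∀ {t F} → All (Disjoint t) F → All (Disjoint t) (gather F)
    gather-Disjoint = gather-All λ _ t#u t#v →
      Disjoint-sym (Disjoint-node (Disjoint-sym t#u) (Disjoint-sym t#v))

  -- Being apart from s is inherited by fused trees, so the trees that absorb t
  -- and the later ones all stay apart from a tree s that was passed over.
  insert-Apart : ∀ {t F} → All (Disjoint t) F → AllPairs Apart F →
    AllPairs Apart (insert t F)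
  insert-Apart []          []           = [] ∷ []
  insert-Apart {t} {s ∷ F} (t#s ∷ t#F) (s≁F ∷ F≁) with linked? (cluster t) (cluster s)
  ... | yes _  = insert-Apart (Disjoint-nodes t#F (All.map proj₁ s≁F)) F≁
  ... | no t≁s = insert-All closed (Apart-sym (t#s , t≁s)) s≁F ∷ insert-Apart t#F F≁
    where
    closed : LinkClosed (Apart s)
    closed _ s≁u s≁v = Apart-sym (Apart-node (Apart-sym s≁u) (Apart-sym s≁v))

  gather-Apart : ∀ {F} → AllPairs Disjoint F → AllPairs Apart (gather F)
  gather-Apart []        = []
  gather-Apart (t# ∷ F#) = insert-Apart (gather-Disjoint t#) (gather-Apart F#)

  -- The properties which a tree passes on to every tree that swallows it, so
  -- that one witness in a forest still yields one after fusion.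
  Persistent : (BinaryTree n → Set) → Set
  Persistent P = ∀ {t s} → Disjoint t s → P t ⊎ P s → P (node t _ s)

  insert-Any : ∀ {P} → Persistent P → ∀ {t F} →
    All (Disjoint t) F → AllPairs Disjoint F → Any P (t ∷ F) → Any P (insert t F)
  insert-Any up [] [] i = i
  insert-Any {P} up {t} {s ∷ F} (t#s ∷ t#F) (s#F ∷ F#) i
    with linked? (cluster t) (cluster s)
  ... | yes _ = insert-Any up (Disjoint-nodes t#F s#F) F# (fuse i)
    where
    fuse : Any P (t ∷ s ∷ F) → Any P (node t _ s ∷ F)
    fuse (here pt)          = here (up t#s (inj₁ pt))
    fuse (there (here ps))  = here (up t#s (inj₂ ps))
    fuse (there (there pF)) = there pF
  ... | no _ = pass i
    where
    pass : Any P (t ∷ s ∷ F) → Any P (s ∷ insert t F)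
    pass (here pt)          = there (insert-Any up t#F F# (here pt))
    pass (there (here ps))  = here ps
    pass (there (there pF)) = there (insert-Any up t#F F# (there pF))

  gather-Any : ∀ {P} → Persistent P → ∀ {F} →
    AllPairs Disjoint F → Any P F → Any P (gather F)
  gather-Any {P} up {t ∷ F} (t# ∷ F#) i = insert-Any up (gather-Disjoint t#)
    (AllPairs.map proj₁ (gather-Apart F#)) (step i)
    where
    step : Any P (t ∷ F) → Any P (t ∷ gather F)
    step (here pt)  = here pt
    step (there pF) = there (gather-Any up F# pF)

  insert-↭ : ∀ t F → forestLeaves (insert t F) ↭ leavesOf t ++ forestLeaves F
  insert-↭ t [] = ↭-refl
  insert-↭ t (s ∷ F) with linked? (cluster t) (cluster s)
  ... | yes _ = begin
    forestLeaves (insert (node t _ s) F)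
      ↭⟨ insert-↭ (node t _ s) F ⟩
    leavesOf (node t _ s) ++ forestLeaves F
      ≡⟨ cong (_++ forestLeaves F) (leavesOf-node t _ s) ⟩
    (leavesOf t ++ leavesOf s) ++ forestLeaves F
      ≡⟨ ++-assoc (leavesOf t) (leavesOf s) (forestLeaves F) ⟩
    leavesOf t ++ leavesOf s ++ forestLeaves F ∎
    where open PermutationReasoning
  ... | no _ = begin
    leavesOf s ++ forestLeaves (insert t F)
      ↭⟨ ++⁺ˡ (leavesOf s) (insert-↭ t F) ⟩
    leavesOf s ++ leavesOf t ++ forestLeaves F
      ↭⟨ shifts (leavesOf s) (leavesOf t) ⟩
    leavesOf t ++ leavesOf s ++ forestLeaves F ∎
    where open PermutationReasoning

  gather-↭ : ∀ F → forestLeaves (gather F) ↭ forestLeaves F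
  gather-↭ []      = ↭-refl
  gather-↭ (t ∷ F) =
    ↭-trans (insert-↭ t (gather F)) (++⁺ˡ (leavesOf t) (gather-↭ F))

  -- Hierarchies on the components of each cluster

  -- When no label is repeated, one hierarchy for each connected component of the
  -- graph induced on the cluster. Only the trees of the two children are fused, so the hierarchies
  -- built lower down survive as subtrees.
  components : BinaryTree n → Forest
  components (leaf x)     = [ leaf x ]
  components (node l _ r) = gather (components l ++ components r)

  components-↭ : ∀ h → forestLeaves (components h) ↭ leavesOf h
  components-↭ (leaf x)     = ↭-refl
  components-↭ (node l u r) = begin
    forestLeaves (gather (components l ++ components r))
      ↭⟨ gather-↭ (components l ++ components r) ⟩
    forestLeaves (components l ++ components r)
      ≡⟨ concatMap-++ leavesOf (components l) (components r) ⟩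
    forestLeaves (components l) ++ forestLeaves (components r)
      ↭⟨ ++⁺ (components-↭ l) (components-↭ r) ⟩
    leavesOf l ++ leavesOf r
      ≡⟨ leavesOf-node l u r ⟨
    leavesOf (node l u r) ∎
    where open PermutationReasoning

  components-⊆ : ∀ h → All (λ t → cluster t ⊆ cluster h) (components h)
  components-⊆ (leaf x) = (λ x∈ → x∈) ∷ []
  components-⊆ (node l _ r) = gather-All {_⊆h} (λ {t} {s} → closed {t} {s}) (Allₚ.++⁺
    (All.map (λ t⊆l {_} x∈ → p⊆p∪q (cluster r) (t⊆l x∈)) (components-⊆ l))
    (All.map (λ t⊆r {_} x∈ → q⊆p∪q (cluster l) (cluster r) (t⊆r x∈)) (components-⊆ r)))
    where
    _⊆h : BinaryTree n → Set
    t ⊆h = cluster t ⊆ cluster l ∪ cluster r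

    closed : LinkClosed _⊆h
    closed {t} {s} _ t⊆ s⊆ x∈ = Sum.[ t⊆ , s⊆ ] (x∈p∪q⁻ (cluster t) (cluster s) x∈)

  components-connected : ∀ h → All AllConnected (components h)
  components-connected (leaf x)     = AllConnected-leaf x ∷ []
  components-connected (node l _ r) = gather-All AllConnected-node
    (Allₚ.++⁺ (components-connected l) (components-connected r))

  components-Apart : ∀ h → Unique (leavesOf h) → AllPairs Apart (components h)

  -- Components of the same child are apart by induction, and components of
  -- different children lie in the disjoint clusters of these children.
  components-Disjoint : ∀ l u r → Unique (leavesOf (node l u r)) →
    AllPairs Disjoint (components l ++ components r)
  components-Disjoint l u r unique =
    let unique-l , unique-r , l#r = Unique-node l u r unique
    in AllPairsₚ.++⁺
      (AllPairs.map proj₁ (components-Apart l unique-l))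
      (AllPairs.map proj₁ (components-Apart r unique-r))
      (All.map (λ t⊆l → All.map (λ s⊆r → disjoint λ x∈t x∈s →
                                   separate l#r (t⊆l x∈t) (s⊆r x∈s))
                                (components-⊆ r))
               (components-⊆ l))

  components-Apart (leaf x)     unique = [] ∷ []
  components-Apart (node l u r) unique = gather-Apart (components-Disjoint l u r unique)

  components-cover : ∀ h {x} → x ∈ cluster h → Any (λ t → x ∈ cluster t) (components h)
  components-cover h {x} x∈h =
    Any.map (λ {t} → leaf⇒cluster t)
      (Anyₚ.concatMap⁻ leavesOf
        (∈-resp-↭ (↭-sym (components-↭ h)) (cluster⇒leaf h x∈h)))

  adjacent-together : ∀ {F x y} → AllPairs Apart F → Adjacent x y →
    Any (λ t → x ∈ cluster t) F → Any (λ t → y ∈ cluster t) F →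
    Any (λ t → x ∈ cluster t × y ∈ cluster t) F
  adjacent-together _        xy (here x∈t) (here y∈t) = here (x∈t , y∈t)
  adjacent-together (_ ∷ F≁) xy (there i)  (there j)  = there (adjacent-together F≁ xy i j)
  adjacent-together (t≁ ∷ _) xy (here x∈t) (there j)  =
    let (_ , t≁s) , y∈s = All.lookupAny t≁ j in ⊥-elim (t≁s (_ , _ , x∈t , y∈s , xy))
  adjacent-together (t≁ ∷ _) xy (there i)  (here y∈t) =
    let (_ , t≁s) , x∈s = All.lookupAny t≁ i
    in ⊥-elim (t≁s (_ , _ , y∈t , x∈s , Adjacent-sym xy))

  Within-persistent : ∀ {k x y} → Persistent (Within k x y)
  Within-persistent t#s (inj₁ w) = Within-nodeˡ w
  Within-persistent t#s (inj₂ w) = Within-nodeʳ t#s w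

  -- Follows the descent from h to the common ancestor of x and y. While both lie
  -- in one child, the tree found for that child survives, bound included, in a
  -- larger one. At the ancestor itself the whole cluster of h is the bound, and
  -- it is met by any tree that contains both, since its cluster is a part of h.
  components-Within : ∀ h → Unique (leavesOf h) → ∀ {x y} → Adjacent x y →
    x ∈ cluster h → y ∈ cluster h →
    Any (Within ∣ cluster (lca h x y) ∣ x y) (components h)
  components-Within (leaf z) unique xy x∈ y∈ = here (within x∈ y∈ ℕₚ.≤-refl)
  components-Within h@(node l u r) unique {x} {y} xy x∈ y∈
    with unique-l , unique-r , _ ← Unique-node l u r unique
    with (x ∈? cluster l) ×-dec (y ∈? cluster l)
       | (x ∈? cluster r) ×-dec (y ∈? cluster r)
  ... | yes (x∈l , y∈l) | _ =
    gather-Any Within-persistent (components-Disjoint l u r unique)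
      (Anyₚ.++⁺ˡ (components-Within l unique-l xy x∈l y∈l))
  ... | no _ | yes (x∈r , y∈r) =
    gather-Any Within-persistent (components-Disjoint l u r unique)
      (Anyₚ.++⁺ʳ (components l) (components-Within r unique-r xy x∈r y∈r))
  ... | no _ | no _ = Any.map (λ {t} ((x∈t , y∈t) , t⊆h) →
      within x∈t y∈t (p⊆q⇒∣p∣≤∣q∣ λ z∈ → t⊆h (lca⊆ t x y z∈)))
    (zipAny (components-⊆ h) (adjacent-together (components-Apart h unique) xy
      (components-cover h x∈) (components-cover h y∈)))
    where
    zipAny : ∀ {P Q : BinaryTree n → Set} {F} → All Q F → Any P F →
      Any (λ t → P t × Q t) F
    zipAny (q ∷ _)  (here p)  = here (p , q)
    zipAny (_ ∷ qs) (there i) = there (zipAny qs i)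

  -- A step out of the cluster of t would be an edge to another tree of the
  -- forest.
  apart-walk : ∀ {t F} → AllPairs Apart (t ∷ F) →
    (∀ x → Any (λ s → x ∈ cluster s) (t ∷ F)) →
    ∀ {x y} → x ∈ cluster t → Star Adjacent x y → y ∈ cluster t
  apart-walk F≁ cover x∈t ε = x∈t
  apart-walk {t} F≁@(t≁ ∷ _) cover x∈t (_◅_ {j = z} xz zy) with cover z
  ... | here z∈t = apart-walk F≁ cover z∈t zy
  ... | there i  =
    let (_ , t≁s) , z∈s = All.lookupAny t≁ i in ⊥-elim (t≁s (_ , z , x∈t , z∈s , xz))

  -- The vertex rules out the empty forest; a second tree would be reached by a
  -- walk that can never leave the first.
  apart-singleton : ∀ F → Fin n → Connected Adjacent → AllPairs Apart F →
    (∀ x → Any (λ s → x ∈ cluster s) F) → ∃[ t ] F ≡ [ t ]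
  apart-singleton []          v conn F≁ cover with () ← cover v
  apart-singleton (t ∷ [])    v conn F≁ cover = t , refl
  apart-singleton (t ∷ s ∷ F) v conn F≁@(((t#s , _) ∷ _) ∷ _) cover =
    let x , x∈t = cluster-nonempty t
        y , y∈s = cluster-nonempty s
    in ⊥-elim (separate t#s (apart-walk F≁ cover x∈t (conn x y)) y∈s)

  connectedHierarchy : Fin n → Connected Adjacent → (H : Hierarchy n) →
    Σ[ T ∈ Hierarchy n ] ( AllConnected (tree T)
      × (∀ x y → Adjacent x y → ∣ C T x y ∣ ≤ ∣ C H x y ∣) )
  connectedHierarchy v conn H =
    let t , F≡[t] = apart-singleton (components h) v conn (components-Apart h unique)
          (components-cover h ∘ spanning)
    in mkHierarchy t (↭-trans
         (↭-reflexive (trans (sym (++-identityʳ (leavesOf t)))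
                             (cong forestLeaves (sym F≡[t]))))
         (↭-trans (components-↭ h) (leaves H))) ,
       All.head (subst (All AllConnected) F≡[t] (components-connected h)) ,
       λ x y xy → lcaSize (Any.head (λ ()) (subst (Any _) F≡[t]
         (components-Within h unique xy (spanning x) (spanning y))))
    where
    h : BinaryTree n
    h = tree H

    unique : Unique (leavesOf h)
    unique = Permutation.Unique-resp-↭ (setoid (Fin n))
      (↭⇒↭ₛ (↭-sym (leaves H))) (allFin⁺ n)

    spanning : ∀ x → x ∈ cluster h
    spanning x = leaf⇒cluster h (∈-resp-↭ (↭-sym (leaves H)) (∈-allFin x))

lemma3 : (n : ℕ) → 2 ≤ n →
    (G : Graph n) → Connected (Graph.Adjacent G) →
    (w : Graph.Edge G → ℝ) → (∀ e → 0ℝ <ℝ w e) →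
    (H : Hierarchy n) →
    Σ[ T ∈ Hierarchy n ]
    ( (∀ s → s ⊑ tree T → Connected (Graph.Induced G (cluster s)))
    × (∀ x y → Graph.Adjacent G x y → ∣ C T x y ∣ ≤ ∣ C H x y ∣)
    × costD⁻ G w T ≤ℝ costD⁻ G w H
    × costD G w T ≤ℝ costD G w H )
lemma3 n _ G conn w 0<w H =
  let v , _ = cluster-nonempty (tree H)
      T , connected , C≤C = ConnectedRefinement.connectedHierarchy G v conn H
  in T , connected , C≤C , costD⁻-mono G w 0<w T H C≤C , costD-mono G w 0<w T H C≤C
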